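{- Let $\gamma\in\mathcal S_n$ and $\sigma=(\varepsilon,\varepsilon,\gamma;(123))$. Fix a positive integer $d$, and let $r$ be the number of cycles of $\gamma$ of length $d$. Suppose there do not exist lengths $d',d''$ of cycles of $\gamma$ (not necessarily distinct cycles) with $d\notin\{d',d''\}$ and $\operatorname{lcm}(d,d')=\operatorname{lcm}(d,d'')=\operatorname{lcm}(d',d'')$. Then $\sigma\notin\mathrm{Par}(n)$ if either <ul> <li>(i) $r=1$ and $n+d\equiv1\pmod3$, or</li> <li>(ii) $3\mid d$ and $3\nmid nr$.</li> </ul>
   Context: A Latin square of order $n$ is an $n\times n$ array with rows, columns and symbols indexed by $[n]$, each symbol occurring once in each row and each column, with triple set $O(L)$. Permutations act on the right; $\varepsilon$ is the identity; fixed points count as cycles of length $1$. A paratopism $(\alpha,\beta,\gamma;(123))$ maps $L$ to $L^\sigma$ with triple set $\{(z\gamma,x\alpha,y\beta):(x,y,z)\in O(L)\}$; it is an autoparatopism of $L$ if $L^\sigma=L$. $\mathrm{Par}(n)$ is the set of paratopisms that are autoparatopisms of at least one Latin square of order $n$. -}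

module Defs where

import Data.Bool.Properties as Bool
open import Data.Fin using (Fin)
open import Data.Fin.Patterns using (0F; 1F; 2F)
open import Data.Fin.Permutation using (Permutation′; permutation; _⟨$⟩ʳ_; _⟨$⟩ˡ_)
open import Data.Fin.Subset using (Subset; ∣_∣; ⁅_⁆; ⋃)
open import Data.List using (List; map; iterate; deduplicate; filter; length; allFin)
open import Data.Nat using (ℕ; _≟_)
open import Data.Product using (_×_; ∃; ∃-syntax; ∃!)
open import Data.Vec using (Vec; []; _∷_; lookup; tabulate)
open import Data.Vec.Properties using (≡-dec)
open import Level using (0ℓ)
open import Relation.Binary.PropositionalEquality using (_≡_; refl)
open import Relation.Unary using (Pred; _≐_)

record LatinSquare (n : ℕ) : Set where
  field
    entry : Fin n → Fin n → Fin n
    row   : ∀ x z → ∃! _≡_ λ y → entry x y ≡ z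
    col   : ∀ y z → ∃! _≡_ λ x → entry x y ≡ z

Triple : ℕ → Set
Triple n = Vec (Fin n) 3

O : ∀ {n} → LatinSquare n → Pred (Triple n) 0ℓ
O L (x ∷ y ∷ z ∷ []) = LatinSquare.entry L x y ≡ z

-- (α , β , γ ; δ) is  paratopism (α ∷ β ∷ γ ∷ []) δ.
record Paratopism (n : ℕ) : Set where
  constructor paratopism
  field
    perms : Vec (Permutation′ n) 3
    δ     : Permutation′ 3

-- The i-th coordinate is permuted by the i-th component and then moved to
-- position iδ; hence position j receives the coordinate jδ⁻¹.
act : ∀ {n} → Paratopism n → Triple n → Triple n
act (paratopism πs δ) t = tabulate λ j → let i = δ ⟨$⟩ˡ j in lookup πs i ⟨$⟩ʳ lookup t i

c123 : Permutation′ 3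
c123 = permutation to from to∘from from∘to
  where
  to from : Fin 3 → Fin 3
  to 0F = 1F
  to 1F = 2F
  to 2F = 0F
  from 0F = 2F
  from 1F = 0F
  from 2F = 1F

  to∘from : ∀ i → to (from i) ≡ i
  to∘from 0F = refl
  to∘from 1F = refl
  to∘from 2F = refl

  from∘to : ∀ i → from (to i) ≡ i
  from∘to 0F = refl
  from∘to 1F = refl
  from∘to 2F = refl

act-c123 : ∀ {n} (α β γ : Permutation′ n) (x y z : Fin n) →
  act (paratopism (α ∷ β ∷ γ ∷ []) c123) (x ∷ y ∷ z ∷ [])
    ≡ (γ ⟨$⟩ʳ z) ∷ (α ⟨$⟩ʳ x) ∷ (β ⟨$⟩ʳ y) ∷ []
act-c123 α β γ x y z = refl

-- The triple set of L^σ.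
O^ : ∀ {n} → LatinSquare n → Paratopism n → Pred (Triple n) 0ℓ
O^ L σ t = ∃[ s ] (O L s × act σ s ≡ t)

IsAutoparatopism : ∀ {n} → Paratopism n → LatinSquare n → Set
IsAutoparatopism σ L = O^ L σ ≐ O L

Par : (n : ℕ) → Pred (Paratopism n) 0ℓ
Par n σ = ∃ λ (L : LatinSquare n) → IsAutoparatopism σ L

-- The cycle through x as a set: {x, xγ, …, xγⁿ⁻¹}.  Cycles have at most n
-- elements, so these n iterates exhaust it.
cycleOf : ∀ {n} → Permutation′ n → Fin n → Subset n
cycleOf {n} γ x = ⋃ (map ⁅_⁆ (iterate (γ ⟨$⟩ʳ_) x n))

-- Each cycle (fixed points included) is listed exactly once.
cycles : ∀ {n} → Permutation′ n → List (Subset n)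
cycles {n} γ = deduplicate (≡-dec Bool._≟_) (map (cycleOf γ) (allFin n))

cycleLengths : ∀ {n} → Permutation′ n → List ℕ
cycleLengths γ = map ∣_∣ (cycles γ)

numCycles : ∀ {n} → Permutation′ n → ℕ → ℕ
numCycles γ d = length (filter (λ C → ∣ C ∣ ≟ d) (cycles γ))

{-# OPTIONS --safe #-}

-- Let D be the set of the rd points on d-cycles.  The cube of σ is the automorphism γ of L, so
-- the cycle lengths met by a triple of L have equal pairwise lcms; by hypothesis no triple has
-- exactly one coordinate in D.  Counting along a row x ∈ D then gives 2|D| − n triples inside
-- D³, hence rd(2rd − n) in all.  The σ-orbits on them have length 3d, or d for the triples
-- fixed by σᵈ; a triple of the latter kind is determined by one coordinate, so there are qd of
-- them with q ≤ r, and q = 0 if 3 ∣ d.  Thus q + rn ≡ 2r²d (mod 3), which excludes (i) and (ii).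
module Submission where

open import Defs
open import Data.Bool using (true; false)
import Data.Bool.Properties as Bool
open import Data.Empty using (⊥-elim)
open import Data.Fin using (Fin; zero; suc; toℕ)
import Data.Fin.Properties as Fin
open import Data.Fin.Permutation using (Permutation′; id; _⟨$⟩ʳ_; _⟨$⟩ˡ_; inverseˡ)
open import Data.Fin.Subset using (Subset; ∣_∣; ⁅_⁆; ⋃) renaming (_∈_ to _∈ₛ_)
open import Data.Fin.Subset.Properties using (x∈⁅x⁆; x∈⁅y⁆⇒x≡y; x∈p∪q⁻; x∈p∪q⁺; ∉⊥; ⊆-antisym; drop-there; ∣p∣≤n) renaming (_∈?_ to _∈ₛ?_)
open import Data.List using (List; []; _∷_; _++_; length; map; filter; allFin; applyUpTo; cartesianProduct)
import Data.List as List
open import Data.List.Membership.Propositional using (_∈_)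
open import Data.List.Membership.Propositional.Properties using (∈-∃++; ∈-++⁺ˡ; ∈-++⁺ʳ; ∈-++⁻; ∈-filter⁺; ∈-filter⁻; ∈-map⁺; ∈-map⁻; ∈-allFin; ∈-applyUpTo⁺; ∈-applyUpTo⁻; ∈-cartesianProduct⁺; ∈-cartesianProduct⁻; ∈-deduplicate⁺; ∈-deduplicate⁻)
open import Data.List.Properties using (length-++; length-map; length-applyUpTo; length-tabulate; filter-++; filter-≐; filter-notAll; map-tabulate)
open import Data.List.Relation.Binary.Subset.Propositional using (_⊆_)
open import Data.List.Relation.Unary.All using ([]; _∷_)
import Data.List.Relation.Unary.All as All
open import Data.List.Relation.Unary.AllPairs using ([]; _∷_)
open import Data.List.Relation.Unary.Any using (here; there; any?)
open import Data.List.Relation.Unary.Unique.Propositional using (Unique)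
import Data.List.Relation.Unary.Unique.Propositional.Properties as Unique
open import Data.List.Relation.Unary.Unique.DecPropositional.Properties using (deduplicate-!)
open import Data.Nat using (ℕ; zero; suc; _+_; _*_; _∸_; pred; _≤_; _<_; _≟_; z≤n; s≤s; z<s; NonZero; >-nonZero)
open import Data.Nat.DivMod using (_%_; _/_; m≡m%n+[m/n]*n; m%n<n; %-distribˡ-+)
open import Data.Nat.Divisibility using (_∣_; _∤_; divides; ∣-antisym; ∣-refl; >⇒∤; _∣0; ∣m∣n⇒∣m+n; ∣m+n∣m⇒∣n; m∣m*n; ∣n⇒∣m*n; m%n≡0⇒n∣m; n∣m⇒m%n≡0)
open import Data.Nat.GeneralisedArithmetic using (iterate)
open import Data.Nat.Induction using (<-rec)
open import Data.Nat.LCM using (lcm; lcm-least; m∣lcm[m,n]; n∣lcm[m,n])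
open import Data.Nat.Properties
open import Data.Nat.Tactic.RingSolver using (solve-∀)
open import Data.Product using (_×_; _,_; proj₁; proj₂; ∃-syntax)
import Data.Product.Properties as Product
open import Data.Sum using (_⊎_; inj₁; inj₂)
open import Data.Vec using ([]; _∷_)
import Data.Vec as Vec
import Data.Vec.Properties as Vec
open import Function using (_∘_)
open import Level using (0ℓ)
open import Relation.Binary using (DecidableEquality)
open import Relation.Binary.PropositionalEquality using (_≡_; _≢_; refl; sym; trans; cong; cong₂; subst; module ≡-Reasoning)
open import Relation.Nullary using (¬_; yes; no; contradiction; ¬?; does)
open import Relation.Nullary.Decidable using (decidable-stable; _×-dec_)
open import Relation.Unary using (Pred; Decidable; _∉_)

private variable
  A B : Set

-- Counting in lists

module _ {P : Pred A 0ℓ} (P? : Decidable P) where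

  length-filter-split : ∀ xs → length (filter P? xs) + length (filter (¬? ∘ P?) xs) ≡ length xs
  length-filter-split [] = refl
  length-filter-split (x ∷ xs) with does (P? x)
  ... | true  = cong suc (length-filter-split xs)
  ... | false = trans (+-suc _ _) (cong suc (length-filter-split xs))

  length-filter-map : ∀ (g : B → A) xs → length (filter P? (map g xs)) ≡ length (filter (P? ∘ g) xs)
  length-filter-map g [] = refl
  length-filter-map g (x ∷ xs) with does (P? (g x))
  ... | true  = cong suc (length-filter-map g xs)
  ... | false = length-filter-map g xs

-- Each element of `xs` removes one occurrence from `ys`. The rest of `xs` still embeds in what
-- remains, because its elements differ from the one removed.
Unique-⊆⇒length≤ : ∀ {xs ys : List A} → Unique xs → xs ⊆ ys → length xs ≤ length ys
Unique-⊆⇒length≤ [] _ = z≤n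
Unique-⊆⇒length≤ {xs = x ∷ xs} (x∉xs ∷ xs!) xs⊆ys
  with as , bs , refl ← ∈-∃++ (xs⊆ys (here refl)) = begin
  suc (length xs)              ≤⟨ s≤s (Unique-⊆⇒length≤ xs! (λ z∈xs → skip (All.lookup x∉xs z∈xs) (xs⊆ys (there z∈xs)))) ⟩
  suc (length (as ++ bs))      ≡⟨ cong suc (length-++ as) ⟩
  suc (length as + length bs)  ≡⟨ +-suc (length as) (length bs) ⟨
  length as + suc (length bs)  ≡⟨ length-++ as ⟨
  length (as ++ x ∷ bs)        ∎
  where
  open ≤-Reasoning
  skip : ∀ {z} → x ≢ z → z ∈ as ++ x ∷ bs → z ∈ as ++ bs
  skip x≢z z∈ with ∈-++⁻ as z∈
  ... | inj₁ z∈as          = ∈-++⁺ˡ z∈as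
  ... | inj₂ (here z≡x)    = contradiction (sym z≡x) x≢z
  ... | inj₂ (there z∈bs)  = ∈-++⁺ʳ as z∈bs

Unique-≋⇒length≡ : ∀ {xs ys : List A} → Unique xs → Unique ys → xs ⊆ ys → ys ⊆ xs → length xs ≡ length ys
Unique-≋⇒length≡ xs! ys! xs⊆ys ys⊆xs =
  ≤-antisym (Unique-⊆⇒length≤ xs! xs⊆ys) (Unique-⊆⇒length≤ ys! ys⊆xs)

module _ (_≟ᴮ_ : DecidableEquality B) (key : A → B) (m : ℕ) where

  fibre : B → List A → List A
  fibre b = filter (λ x → key x ≟ᴮ b)

  -- Induction on the keys: discarding the fibre over `b` leaves every other fibre intact, since the
  -- keys are distinct. It serves to count points on cycles, with the cycle as key.
  length-uniform-fibres : ∀ bs xs → Unique bs → (∀ {x} → x ∈ xs → key x ∈ bs) →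
    (∀ {b} → b ∈ bs → length (fibre b xs) ≡ m) → length xs ≡ length bs * m
  length-uniform-fibres [] [] _ _ _ = refl
  length-uniform-fibres [] (x ∷ xs) _ keys _ with () ← keys (here refl)
  length-uniform-fibres (b ∷ bs) xs (b∉bs ∷ bs!) keys fibres = begin
    length xs                          ≡⟨ length-filter-split _ xs ⟨
    length (fibre b xs) + length rest  ≡⟨ cong₂ _+_ (fibres (here refl)) (length-uniform-fibres bs rest bs! keys′ fibres′) ⟩
    m + length bs * m                  ∎
    where
    open ≡-Reasoning
    other? : Decidable (λ x → ¬ (key x ≡ b))
    other? x = ¬? (key x ≟ᴮ b)
    rest : List A
    rest = filter other? xs
    keys′ : ∀ {x} → x ∈ rest → key x ∈ bs
    keys′ x∈ with x∈xs , k≢b ← ∈-filter⁻ other? {xs = xs} x∈ with keys x∈xs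
    ... | here k≡b   = contradiction k≡b k≢b
    ... | there k∈bs = k∈bs
    drop-other : ∀ {c} → b ≢ c → ∀ ys → fibre c (filter other? ys) ≡ fibre c ys
    drop-other b≢c [] = refl
    drop-other {c} b≢c (y ∷ ys) with key y ≟ᴮ b
    drop-other {c} b≢c (y ∷ ys) | yes k≡b with key y ≟ᴮ c
    ... | yes k≡c = contradiction (trans (sym k≡b) k≡c) b≢c
    ... | no  _   = drop-other b≢c ys
    drop-other {c} b≢c (y ∷ ys) | no _ with does (key y ≟ᴮ c)
    ... | true  = cong (y ∷_) (drop-other b≢c ys)
    ... | false = drop-other b≢c ys
    fibres′ : ∀ {c} → c ∈ bs → length (fibre c rest) ≡ m
    fibres′ c∈ = trans (cong length (drop-other (All.lookup b∉bs c∈) xs)) (fibres (there c∈))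

-- Each row contributes m - n pairs. The n is carried on the left so that no truncated subtraction
-- occurs.
length-filter-cartesianProduct : ∀ {P : Pred (A × B) 0ℓ} (P? : Decidable P) (ys : List B) (n m : ℕ) xs →
  (∀ {x} → x ∈ xs → length (filter (λ y → P? (x , y)) ys) + n ≡ m) →
  length (filter P? (cartesianProduct xs ys)) + length xs * n ≡ length xs * m
length-filter-cartesianProduct P? ys n m [] rows = refl
length-filter-cartesianProduct P? ys n m (x ∷ xs) rows = begin
  length (filter P? (row ++ rest)) + (n + length xs * n)
    ≡⟨ cong (λ l → length l + (n + length xs * n)) (filter-++ P? row rest) ⟩
  length (filter P? row ++ filter P? rest) + (n + length xs * n)
    ≡⟨ cong (_+ (n + length xs * n)) (length-++ (filter P? row)) ⟩
  length (filter P? row) + length (filter P? rest) + (n + length xs * n)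
    ≡⟨ interchange (length (filter P? row)) _ n _ ⟩
  (length (filter P? row) + n) + (length (filter P? rest) + length xs * n)
    ≡⟨ cong₂ _+_ (trans (cong (_+ n) (length-filter-map P? (x ,_) ys)) (rows (here refl)))
                 (length-filter-cartesianProduct P? ys n m xs (rows ∘ there)) ⟩
  m + length xs * m ∎
  where
  open ≡-Reasoning
  row rest : List _
  row = map (x ,_) ys
  rest = cartesianProduct xs ys
  interchange : ∀ a b c e → a + b + (c + e) ≡ (a + c) + (b + e)
  interchange = solve-∀

length-filter-∈ₛ : ∀ {n} (p : Subset n) → length (filter (_∈ₛ? p) (allFin n)) ≡ ∣ p ∣
-- The tail of `allFin (suc n)` is `tabulate suc`, which has to be turned into `map suc (allFin n)`
-- before the induction can proceed.
length-filter-∈ₛ-suc : ∀ {n} b (p : Subset n) → length (filter (_∈ₛ? (b ∷ p)) (List.tabulate suc)) ≡ ∣ p ∣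

length-filter-∈ₛ []          = refl
length-filter-∈ₛ (true  ∷ p) = cong suc (length-filter-∈ₛ-suc true p)
length-filter-∈ₛ (false ∷ p) = length-filter-∈ₛ-suc false p

length-filter-∈ₛ-suc {n} b p = begin
  length (filter (_∈ₛ? (b ∷ p)) (List.tabulate suc))
    ≡⟨ cong (length ∘ filter (_∈ₛ? (b ∷ p))) (map-tabulate (λ i → i) suc) ⟨
  length (filter (_∈ₛ? (b ∷ p)) (map suc (allFin n)))
    ≡⟨ length-filter-map (_∈ₛ? (b ∷ p)) suc (allFin n) ⟩
  length (filter ((_∈ₛ? (b ∷ p)) ∘ suc) (allFin n))
    ≡⟨ cong length (filter-≐ _ (_∈ₛ? p) (drop-there , Vec.there) (allFin n)) ⟩
  length (filter (_∈ₛ? p) (allFin n))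
    ≡⟨ length-filter-∈ₛ p ⟩
  ∣ p ∣ ∎
  where open ≡-Reasoning

-- Iteration and periods

iterate-+ : ∀ (f : A → A) x m k → iterate f x (m + k) ≡ iterate f (iterate f x m) k
iterate-+ f x zero    k = refl
iterate-+ f x (suc m) k = iterate-+ f (f x) m k

iterate-suc : ∀ (f : A → A) x k → iterate f x (suc k) ≡ f (iterate f x k)
iterate-suc f x k = trans (cong (iterate f x) (+-comm 1 k)) (iterate-+ f x k 1)

iterate-* : ∀ (f : A → A) x m → iterate f x m ≡ x → ∀ q → iterate f x (q * m) ≡ x
iterate-* f x m fix zero    = refl
iterate-* f x m fix (suc q) =
  trans (iterate-+ f x m (q * m)) (trans (cong (λ z → iterate f z (q * m)) fix) (iterate-* f x m fix q))

iterate-∣ : ∀ (f : A → A) x {m k} → iterate f x m ≡ x → m ∣ k → iterate f x k ≡ x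
iterate-∣ f x fix (divides q refl) = iterate-* f x _ fix q

iterate-% : ∀ (f : A → A) x m .{{_ : NonZero m}} → iterate f x m ≡ x → ∀ k → iterate f x k ≡ iterate f x (k % m)
iterate-% f x m fix k = begin
  iterate f x k                                ≡⟨ cong (iterate f x) (trans (m≡m%n+[m/n]*n k m) (+-comm (k % m) _)) ⟩
  iterate f x (k / m * m + k % m)              ≡⟨ iterate-+ f x (k / m * m) (k % m) ⟩
  iterate f (iterate f x (k / m * m)) (k % m)  ≡⟨ cong (λ z → iterate f z (k % m)) (iterate-* f x m fix (k / m)) ⟩
  iterate f x (k % m)                          ∎
  where open ≡-Reasoning

record IsPeriod (f : A → A) (x : A) (m : ℕ) : Set where
  field
    positive : 0 < m
    returns  : iterate f x m ≡ x
    minimal  : ∀ {k} → 0 < k → k < m → iterate f x k ≢ x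

-- The length is a free parameter: it is the least period when elements are counted, and n when
-- compared with `cycleOf`.
orbit : (A → A) → A → ℕ → List A
orbit f x m = applyUpTo (iterate f x) m

orbit-mono : ∀ (f : A → A) x {m n} → m ≤ n → orbit f x m ⊆ orbit f x n
orbit-mono f x m≤n y∈ with k , k<m , refl ← ∈-applyUpTo⁻ (iterate f x) y∈ =
  ∈-applyUpTo⁺ (iterate f x) (<-≤-trans k<m m≤n)

module _ {f : A → A} {x : A} {m : ℕ} (per : IsPeriod f x m) where
  open IsPeriod per

  private instance
    m≢0 : NonZero m
    m≢0 = >-nonZero positive

  -- If the iterates i < j < m agreed, then m - j further steps from both would bring x back after i
  -- + (m - j) < m steps, against minimality. Injectivity of `f` is not assumed.
  orbit-Unique : Unique (orbit f x m)
  orbit-Unique = Unique.applyUpTo⁺₁ (iterate f x) m distinct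
    where
    distinct : ∀ {i j} → i < j → j < m → iterate f x i ≢ iterate f x j
    distinct {i} {j} i<j j<m eq = minimal {i + (m ∸ j)} (<-≤-trans (m<n⇒0<n∸m j<m) (m≤n+m _ i)) small (begin
      iterate f x (i + (m ∸ j))          ≡⟨ iterate-+ f x i (m ∸ j) ⟩
      iterate f (iterate f x i) (m ∸ j)  ≡⟨ cong (λ z → iterate f z (m ∸ j)) eq ⟩
      iterate f (iterate f x j) (m ∸ j)  ≡⟨ iterate-+ f x j (m ∸ j) ⟨
      iterate f x (j + (m ∸ j))          ≡⟨ cong (iterate f x) (m+[n∸m]≡n (<⇒≤ j<m)) ⟩
      iterate f x m                      ≡⟨ returns ⟩
      x                                  ∎)
      where
      open ≡-Reasoning
      small : i + (m ∸ j) < m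
      small = subst (i + (m ∸ j) <_) (m+[n∸m]≡n (<⇒≤ j<m)) (+-monoˡ-< (m ∸ j) i<j)

  iterate∈orbit : ∀ k → iterate f x k ∈ orbit f x m
  iterate∈orbit k = subst (_∈ orbit f x m) (sym (iterate-% f x m returns k))
    (∈-applyUpTo⁺ (iterate f x) (m%n<n k m))

  -- The remainder of k modulo m is again a return time, and it is below m, so it must be zero.
  period-∣ : ∀ {k} → iterate f x k ≡ x → m ∣ k
  period-∣ {k} fix with k % m in eq | iterate-% f x m returns k
  ... | zero  | _  = m%n≡0⇒n∣m k m eq
  ... | suc j | e  = contradiction (trans (sym e) fix) (minimal z<s (subst (_< m) eq (m%n<n k m)))

-- Strong induction on the length: the orbit of the head has exactly m elements, and its complement
-- in the list is again closed under `f`.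
length-free-orbits : DecidableEquality A → ∀ (f : A → A) m xs → Unique xs →
  (∀ {x} → x ∈ xs → f x ∈ xs) → (∀ {x} → x ∈ xs → IsPeriod f x m) → m ∣ length xs
length-free-orbits {A = A} _≟ᴬ_ f m xs = <-rec Goal step (length xs) xs refl
  where
  Goal : ℕ → Set
  Goal l = ∀ xs → length xs ≡ l → Unique xs → (∀ {x} → x ∈ xs → f x ∈ xs) →
    (∀ {x} → x ∈ xs → IsPeriod f x m) → m ∣ l
  step : ∀ l → (∀ {k} → k < l → Goal k) → Goal l
  step _ rec []         refl _   _      _   = m ∣0
  step _ rec ys@(x ∷ _) refl ys! closed per =
    subst (m ∣_) (length-filter-split inOrb? ys) (∣m∣n⇒∣m+n m∣orb m∣rest)
    where
    perˣ : IsPeriod f x m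
    perˣ = per (here refl)
    inOrb? : Decidable (_∈ orbit f x m)
    inOrb? y = any? (y ≟ᴬ_) (orbit f x m)
    rest : List A
    rest = filter (¬? ∘ inOrb?) ys
    iterate∈ys : ∀ k → iterate f x k ∈ ys
    iterate∈ys zero    = here refl
    iterate∈ys (suc k) = subst (_∈ ys) (sym (iterate-suc f x k)) (closed (iterate∈ys k))
    orb⊆ys : orbit f x m ⊆ ys
    orb⊆ys y∈ with k , _ , refl ← ∈-applyUpTo⁻ (iterate f x) y∈ = iterate∈ys k
    m∣orb : m ∣ length (filter inOrb? ys)
    m∣orb = subst (m ∣_) (sym (trans
      (Unique-≋⇒length≡ (Unique.filter⁺ inOrb? ys!) (orbit-Unique perˣ)
        (proj₂ ∘ ∈-filter⁻ inOrb? {xs = ys}) (λ y∈ → ∈-filter⁺ inOrb? (orb⊆ys y∈) y∈))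
      (length-applyUpTo (iterate f x) m))) ∣-refl
    -- An element of a periodic orbit is reached from its image by going once around.
    back : ∀ {y} → y ∈ ys → f y ∈ orbit f x m → y ∈ orbit f x m
    back {y} y∈ys fy∈ with k , _ , fy≡ ← ∈-applyUpTo⁻ (iterate f x) fy∈ = subst (_∈ orbit f x m) (begin
      iterate f x (k + pred m)          ≡⟨ iterate-+ f x k (pred m) ⟩
      iterate f (iterate f x k) (pred m)  ≡⟨ cong (λ z → iterate f z (pred m)) fy≡ ⟨
      iterate f y (suc (pred m))        ≡⟨ cong (iterate f y) (suc-pred m {{>-nonZero (IsPeriod.positive perˣ)}}) ⟩
      iterate f y m                     ≡⟨ IsPeriod.returns (per y∈ys) ⟩
      y                                 ∎) (iterate∈orbit perˣ (k + pred m))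
      where open ≡-Reasoning
    m∣rest : m ∣ length rest
    -- The head lies in its own orbit, so `rest` is strictly shorter than `ys`.
    m∣rest = rec (filter-notAll (¬? ∘ inOrb?) ys (here (λ x∉ → x∉ (iterate∈orbit perˣ 0))))
      rest refl (Unique.filter⁺ (¬? ∘ inOrb?) ys!)
      (λ y∈ → let y∈ys , y∉ = ∈-filter⁻ (¬? ∘ inOrb?) {xs = ys} y∈ in
        ∈-filter⁺ (¬? ∘ inOrb?) (closed y∈ys) (y∉ ∘ back y∈ys))
      (λ y∈ → per (proj₁ (∈-filter⁻ (¬? ∘ inOrb?) {xs = ys} y∈)))

-- Descent: a smaller positive return time, if there is one, replaces p. The bound m ≤ p is kept
-- because it later places a whole cycle among the first n iterates.
least-period : DecidableEquality A → ∀ (f : A → A) x p → 0 < p → iterate f x p ≡ x →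
  ∃[ m ] (m ≤ p × IsPeriod f x m)
least-period _≟ᴬ_ f x = <-rec _ step
  where
  step : ∀ p → (∀ {k} → k < p → 0 < k → iterate f x k ≡ x → ∃[ m ] (m ≤ k × IsPeriod f x m)) →
    0 < p → iterate f x p ≡ x → ∃[ m ] (m ≤ p × IsPeriod f x m)
  step p rec 0<p fix with anyUpTo? (λ k → (0 <? k) ×-dec (iterate f x k ≟ᴬ x)) p
  ... | yes (k , k<p , 0<k , fixᵏ) with m , m≤k , per ← rec k<p 0<k fixᵏ =
    m , ≤-trans m≤k (<⇒≤ k<p) , per
  ... | no none = p , ≤-refl , record
    { positive = 0<p ; returns = fix ; minimal = λ 0<k k<p fixᵏ → none (_ , k<p , 0<k , fixᵏ) }

iterate-injective : ∀ {f : A → A} → (∀ {x y} → f x ≡ f y → x ≡ y) →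
  ∀ k {x y} → iterate f x k ≡ iterate f y k → x ≡ y
iterate-injective inj zero    eq = eq
iterate-injective inj (suc k) eq = inj (iterate-injective inj k eq)

List-iterate≡orbit : ∀ (f : A → A) x m → List.iterate f x m ≡ orbit f x m
List-iterate≡orbit f x zero    = refl
List-iterate≡orbit f x (suc m) = cong (x ∷_) (List-iterate≡orbit f (f x) m)

-- Cycles of a permutation

∈-⋃⁅⁆⁺ : ∀ {n} {x : Fin n} {xs} → x ∈ xs → x ∈ₛ ⋃ (map ⁅_⁆ xs)
∈-⋃⁅⁆⁺ {x = x} (here refl) = x∈p∪q⁺ (inj₁ (x∈⁅x⁆ x))
∈-⋃⁅⁆⁺ (there x∈xs)        = x∈p∪q⁺ (inj₂ (∈-⋃⁅⁆⁺ x∈xs))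

∈-⋃⁅⁆⁻ : ∀ {n} {x : Fin n} xs → x ∈ₛ ⋃ (map ⁅_⁆ xs) → x ∈ xs
∈-⋃⁅⁆⁻ [] x∈ = contradiction x∈ ∉⊥
∈-⋃⁅⁆⁻ (y ∷ ys) x∈ with x∈p∪q⁻ ⁅ y ⁆ _ x∈
... | inj₁ x∈y  = here (x∈⁅y⁆⇒x≡y y x∈y)
... | inj₂ x∈ys = there (∈-⋃⁅⁆⁻ ys x∈ys)

_≟ˢ_ : ∀ {n} → DecidableEquality (Subset n)
_≟ˢ_ = Vec.≡-dec Bool._≟_

module Cycles {n : ℕ} (γ : Permutation′ n) where

  g : Fin n → Fin n
  g = γ ⟨$⟩ʳ_

  g-injective : ∀ {x y} → g x ≡ g y → x ≡ y
  g-injective eq = trans (sym (inverseˡ γ)) (trans (cong (γ ⟨$⟩ˡ_) eq) (inverseˡ γ))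

  len : Fin n → ℕ
  len x = ∣ cycleOf γ x ∣

  -- Two of the n + 1 iterates x, ..., xγⁿ coincide by the pigeonhole principle, and injectivity
  -- cancels the earlier exponent.
  returns-within-n : ∀ x → ∃[ p ] (p ≤ n × 0 < p × iterate g x p ≡ x)
  returns-within-n x with i , j , i<j , eq ← Fin.pigeonhole (n<1+n n) (λ i → iterate g x (toℕ i)) =
    toℕ j ∸ toℕ i , ≤-trans (m∸n≤m _ (toℕ i)) (≤-pred (Fin.toℕ<n j)) , m<n⇒0<n∸m i<j ,
    iterate-injective g-injective (toℕ i) (begin
      iterate g (iterate g x (toℕ j ∸ toℕ i)) (toℕ i)  ≡⟨ iterate-+ g x (toℕ j ∸ toℕ i) (toℕ i) ⟨
      iterate g x (toℕ j ∸ toℕ i + toℕ i)              ≡⟨ cong (iterate g x) (m∸n+n≡m (<⇒≤ i<j)) ⟩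
      iterate g x (toℕ j)                              ≡⟨ eq ⟨
      iterate g x (toℕ i)                              ∎)
    where open ≡-Reasoning

  ∈-cycleOf⁺ : ∀ {x y} → y ∈ orbit g x n → y ∈ₛ cycleOf γ x
  ∈-cycleOf⁺ {x} {y} y∈ = ∈-⋃⁅⁆⁺ (subst (y ∈_) (sym (List-iterate≡orbit g x n)) y∈)

  ∈-cycleOf⁻ : ∀ {x y} → y ∈ₛ cycleOf γ x → ∃[ k ] y ≡ iterate g x k
  ∈-cycleOf⁻ {x} {y} y∈
    with k , _ , y≡ ← ∈-applyUpTo⁻ (iterate g x) (subst (y ∈_) (List-iterate≡orbit g x n) (∈-⋃⁅⁆⁻ _ y∈)) = k , y≡

  -- This turns the cardinality of a cycle into a period. The least period is at most n, so the n
  -- iterates collected by `cycleOf` form the full orbit, which is also listed without repetition by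
  -- `orbit`.
  len-isPeriod : ∀ x → IsPeriod g x (len x)
  len-isPeriod x
    with p , p≤n , 0<p , fix ← returns-within-n x
    with m , m≤p , per ← least-period Fin._≟_ g x p 0<p fix = subst (IsPeriod g x) (begin
      m                                               ≡⟨ length-applyUpTo (iterate g x) m ⟨
      length (orbit g x m)                            ≡⟨ Unique-≋⇒length≡ (orbit-Unique per)
        (Unique.filter⁺ (_∈ₛ? cycleOf γ x) (Unique.allFin⁺ n)) orbit⊆ ⊆orbit ⟩
      length (filter (_∈ₛ? cycleOf γ x) (allFin n))   ≡⟨ length-filter-∈ₛ (cycleOf γ x) ⟩
      len x                                           ∎) per
    where
    open ≡-Reasoning
    orbit⊆ : orbit g x m ⊆ filter (_∈ₛ? cycleOf γ x) (allFin n)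
    orbit⊆ y∈ = ∈-filter⁺ (_∈ₛ? cycleOf γ x) (∈-allFin _) (∈-cycleOf⁺ (orbit-mono g x (≤-trans m≤p p≤n) y∈))
    ⊆orbit : filter (_∈ₛ? cycleOf γ x) (allFin n) ⊆ orbit g x m
    ⊆orbit y∈ with k , refl ← ∈-cycleOf⁻ (proj₂ (∈-filter⁻ (_∈ₛ? cycleOf γ x) {xs = allFin n} y∈)) = iterate∈orbit per k

  len>0 : ∀ x → 0 < len x
  len>0 x = IsPeriod.positive (len-isPeriod x)

  len∣⇒fixed : ∀ {x k} → len x ∣ k → iterate g x k ≡ x
  len∣⇒fixed {x} = iterate-∣ g x (IsPeriod.returns (len-isPeriod x))

  fixed⇒len∣ : ∀ {x k} → iterate g x k ≡ x → len x ∣ k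
  fixed⇒len∣ {x} = period-∣ (len-isPeriod x)

  len-g : ∀ x → len (g x) ≡ len x
  len-g x = ∣-antisym
    (fixed⇒len∣ (trans (iterate-suc g x (len x)) (cong g (len∣⇒fixed ∣-refl))))
    (fixed⇒len∣ (g-injective (trans (sym (iterate-suc g x (len (g x)))) (len∣⇒fixed ∣-refl))))

  len-∈ : ∀ x → len x ∈ cycleLengths γ
  len-∈ x = ∈-map⁺ ∣_∣ (∈-deduplicate⁺ _≟ˢ_ (∈-map⁺ (cycleOf γ) (∈-allFin x)))

  -- The period is the size of a subset of `Fin n`, hence at most n, so reducing k modulo the period
  -- lands among the n iterates of `cycleOf`.
  iterate∈cycleOf : ∀ x k → iterate g x k ∈ₛ cycleOf γ x
  iterate∈cycleOf x k = ∈-cycleOf⁺ (orbit-mono g x (∣p∣≤n (cycleOf γ x)) (iterate∈orbit (len-isPeriod x) k))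

  ∈cycleOf⇒≡ : ∀ {x y} → y ∈ₛ cycleOf γ x → cycleOf γ y ≡ cycleOf γ x
  ∈cycleOf⇒≡ {x} {y} y∈ with k , y≡ ← ∈-cycleOf⁻ y∈ = ⊆-antisym ⊆ˣ ⊇ˣ
    where
    open ≡-Reasoning
    -- From y = xγᵏ, another k(ℓ - 1) steps, with ℓ = `len x`, make kℓ in total and so return to x.
    -- The choice ℓ - k would need k ≤ ℓ.
    x≡ : x ≡ iterate g y (k * pred (len x))
    x≡ = begin
      x                                              ≡⟨ len∣⇒fixed (divides k refl) ⟨
      iterate g x (k * len x)                        ≡⟨ cong (λ m → iterate g x (k * m)) (suc-pred (len x) {{>-nonZero (len>0 x)}}) ⟨
      iterate g x (k * suc (pred (len x)))           ≡⟨ cong (iterate g x) (*-suc k (pred (len x))) ⟩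
      iterate g x (k + k * pred (len x))             ≡⟨ iterate-+ g x k _ ⟩
      iterate g (iterate g x k) (k * pred (len x))   ≡⟨ cong (λ z → iterate g z (k * pred (len x))) y≡ ⟨
      iterate g y (k * pred (len x))                 ∎
    ⊆ˣ : ∀ {z} → z ∈ₛ cycleOf γ y → z ∈ₛ cycleOf γ x
    ⊆ˣ z∈ with j , refl ← ∈-cycleOf⁻ z∈ =
      subst (_∈ₛ cycleOf γ x) (trans (iterate-+ g x k j) (cong (λ z → iterate g z j) (sym y≡))) (iterate∈cycleOf x (k + j))
    ⊇ˣ : ∀ {z} → z ∈ₛ cycleOf γ x → z ∈ₛ cycleOf γ y
    ⊇ˣ z∈ with j , refl ← ∈-cycleOf⁻ z∈ =
      subst (_∈ₛ cycleOf γ y) (trans (iterate-+ g y (k * pred (len x)) j) (cong (λ z → iterate g z j) (sym x≡))) (iterate∈cycleOf y (k * pred (len x) + j))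

  -- Points on cycles of length d

  module _ (d : ℕ) where

    len≟d : Decidable (λ x → len x ≡ d)
    len≟d x = len x ≟ d

    points : List (Fin n)
    points = filter len≟d (allFin n)

    points-Unique : Unique points
    points-Unique = Unique.filter⁺ len≟d (Unique.allFin⁺ n)

    ∈-points⁺ : ∀ {x} → len x ≡ d → x ∈ points
    ∈-points⁺ = ∈-filter⁺ len≟d (∈-allFin _)

    ∈-points⁻ : ∀ {x} → x ∈ points → len x ≡ d
    ∈-points⁻ = proj₂ ∘ ∈-filter⁻ len≟d {xs = allFin n}

    -- The points are sorted by the cycle through them: the keys are the r cycles of size d, and the
    -- fibre over a cycle is that cycle itself.
    length-points : length points ≡ numCycles γ d * d
    length-points = length-uniform-fibres _≟ˢ_ (cycleOf γ) d (filter size? (cycles γ)) points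
      (Unique.filter⁺ size? (deduplicate-! _≟ˢ_ (map (cycleOf γ) (allFin n))))
      (λ x∈ → ∈-filter⁺ size? (∈-deduplicate⁺ _≟ˢ_ (∈-map⁺ (cycleOf γ) (∈-allFin _))) (∈-points⁻ x∈))
      fibres
      where
      size? : Decidable (λ C → ∣ C ∣ ≡ d)
      size? C = ∣ C ∣ ≟ d
      fibres : ∀ {C} → C ∈ filter size? (cycles γ) → length (filter (λ x → cycleOf γ x ≟ˢ C) points) ≡ d
      fibres C∈
        with C∈cycles , ∣C∣≡d ← ∈-filter⁻ size? {xs = cycles γ} C∈
        with x , _ , refl ← ∈-map⁻ (cycleOf γ) (∈-deduplicate⁻ _≟ˢ_ (map (cycleOf γ) (allFin n)) C∈cycles) =
        trans (Unique-≋⇒length≡ (Unique.filter⁺ same? points-Unique) (Unique.filter⁺ (_∈ₛ? cycleOf γ x) (Unique.allFin⁺ n))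
          (λ {y} y∈ → ∈-filter⁺ (_∈ₛ? cycleOf γ x) (∈-allFin y)
            (subst (y ∈ₛ_) (proj₂ (∈-filter⁻ same? {xs = points} y∈)) (iterate∈cycleOf y 0)))
          (λ {y} y∈ → let same = ∈cycleOf⇒≡ (proj₂ (∈-filter⁻ (_∈ₛ? cycleOf γ x) {xs = allFin n} y∈)) in
            ∈-filter⁺ same? (∈-points⁺ (trans (cong ∣_∣ same) ∣C∣≡d)) same))
        (trans (length-filter-∈ₛ (cycleOf γ x)) ∣C∣≡d)
        where
        same? : Decidable (λ y → cycleOf γ y ≡ cycleOf γ x)
        same? y = cycleOf γ y ≟ˢ cycleOf γ x

-- Arithmetic of the orbit count

-- Here f, h and p stand for |F|, |G| and |D|, with F and G the σ-orbits of length d and 3d inside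
-- D³. With f = qd, h = 3sd and p = rd, one factor d cancels throughout.
divide-by-d : ∀ d n r {f h p} .{{_ : NonZero d}} → d ∣ f → 3 * d ∣ h → p ≡ r * d →
  f ≤ p → (3 ∣ d → f ≡ 0) → f + h + p * n ≡ p * (p + p) →
  ∃[ q ] ∃[ s ] (q ≤ r × (3 ∣ d → q ≡ 0) × q + 3 * s + r * n ≡ r * (r * d + r * d))
divide-by-d d n r (divides q refl) (divides s refl) refl f≤p f≡0 eq =
  q , s , *-cancelʳ-≤ q r d f≤p , (λ 3∣d → m*n≡0⇒m≡0 q d (f≡0 3∣d)) , *-cancelʳ-≡ _ _ d (begin
    (q + 3 * s + r * n) * d           ≡⟨ collect q s r n d ⟩
    q * d + s * (3 * d) + r * d * n   ≡⟨ eq ⟩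
    r * d * (r * d + r * d)           ≡⟨ swap r d _ ⟩
    r * (r * d + r * d) * d           ∎)
  where
  open ≡-Reasoning
  collect : ∀ q s r n d → (q + 3 * s + r * n) * d ≡ q * d + s * (3 * d) + r * d * n
  collect = solve-∀
  swap : ∀ r d t → r * d * t ≡ r * t * d
  swap = solve-∀

-- Everything is read modulo 3. In case (ii), q = 0 and 3 divides the right-hand side, forcing 3 to
-- divide rn. In case (i), q is 0 or 1 and 3 would divide q + n + d, which is congruent to 1 or 2.
no-solution : ∀ n d r q s → q ≤ r → (3 ∣ d → q ≡ 0) → q + 3 * s + r * n ≡ r * (r * d + r * d) →
  ¬ ((r ≡ 1 × (n + d) % 3 ≡ 1) ⊎ (3 ∣ d × 3 ∤ n * r))
no-solution n d r q s q≤r q≡0 eq (inj₂ (3∣d , 3∤nr)) with refl ← q≡0 3∣d =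
  3∤nr (subst (3 ∣_) (*-comm r n) (∣m+n∣m⇒∣n (subst (3 ∣_) (sym eq) 3∣rhs) (m∣m*n s)))
  where
  3∣rhs : 3 ∣ r * (r * d + r * d)
  3∣rhs = ∣n⇒∣m*n r (∣m∣n⇒∣m+n (∣n⇒∣m*n r 3∣d) (∣n⇒∣m*n r 3∣d))
no-solution n d _ q s q≤1 _ eq (inj₁ (refl , n+d≡1)) = impossible q q≤1 3∣q+n+d
  where
  open ≡-Reasoning
  left : ∀ n d q s → 3 * s + (q + (n + d)) ≡ q + 3 * s + 1 * n + d
  left = solve-∀
  right : ∀ d → 1 * (1 * d + 1 * d) + d ≡ 3 * d
  right = solve-∀
  -- For r = 1 the right-hand side is 2d, so adding d to both sides makes it a multiple of 3.
  3∣q+n+d : 3 ∣ q + (n + d)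
  3∣q+n+d = ∣m+n∣m⇒∣n (subst (3 ∣_) (sym (begin
    3 * s + (q + (n + d))       ≡⟨ left n d q s ⟩
    q + 3 * s + 1 * n + d       ≡⟨ cong (_+ d) eq ⟩
    1 * (1 * d + 1 * d) + d     ≡⟨ right d ⟩
    3 * d                       ∎)) (m∣m*n d)) (m∣m*n s)
  impossible : ∀ q → q ≤ 1 → ¬ (3 ∣ q + (n + d))
  impossible 0 _ 3∣ with () ← trans (sym n+d≡1) (n∣m⇒m%n≡0 (n + d) 3 3∣)
  impossible 1 _ 3∣ with () ← trans (sym (trans (%-distribˡ-+ 1 (n + d) 3) (cong (λ m → (1 + m) % 3) n+d≡1))) (n∣m⇒m%n≡0 (1 + (n + d)) 3 3∣)
  impossible (suc (suc _)) (s≤s ()) _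

-- Latin squares with the autoparatopism (ε , ε , γ ; (123))

module Cells {n : ℕ} (γ : Permutation′ n) (L : LatinSquare n)
  (rotate : ∀ x y → LatinSquare.entry L (γ ⟨$⟩ʳ LatinSquare.entry L x y) x ≡ y) where

  open LatinSquare L renaming (entry to _·_)
  open Cycles γ

  cancelˡ : ∀ x {y y′} → x · y ≡ x · y′ → y ≡ y′
  cancelˡ x {y} {y′} eq with _ , _ , unique ← row x (x · y′) = trans (sym (unique eq)) (unique refl)

  cancelʳ : ∀ y {x x′} → x · y ≡ x′ · y → x ≡ x′
  cancelʳ y {x} {x′} eq with _ , _ , unique ← col y (x′ · y) = trans (sym (unique eq)) (unique refl)

  -- The second application of the paratopism: `rotate` at the cell (g (x · y), x), whose symbol is
  -- y by `rotate` itself.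
  rotate² : ∀ x y → g y · g (x · y) ≡ x
  rotate² x y = trans (cong (λ w → g w · g (x · y)) (sym (rotate x y))) (rotate (g (x · y)) x)

  -- The third application brings every coordinate back to its own position with one `g` applied, so
  -- the cube of the paratopism is (γ, γ, γ).
  g-automorphism : ∀ x y → g x · g y ≡ g (x · y)
  g-automorphism x y = trans (cong (λ w → g w · g y) (sym (rotate² x y))) (rotate (g y) (g (x · y)))

  iterate-automorphism : ∀ k x y → iterate g x k · iterate g y k ≡ iterate g (x · y) k
  iterate-automorphism zero    x y = refl
  iterate-automorphism (suc k) x y =
    trans (iterate-automorphism k (g x) (g y)) (cong (λ z → iterate g z k) (g-automorphism x y))

  -- Cycle lengths met by a triple

  module _ {x y : Fin n} (k : ℕ) where

    -- In this lemma and the next two: the k-th power of `g` is an automorphism, and two coordinates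
    -- of a triple determine the third, so fixing two of them fixes the third.
    fixed-· : iterate g x k ≡ x → iterate g y k ≡ y → iterate g (x · y) k ≡ x · y
    fixed-· fx fy = trans (sym (iterate-automorphism k x y)) (cong₂ _·_ fx fy)

    fixed-right : iterate g x k ≡ x → iterate g (x · y) k ≡ x · y → iterate g y k ≡ y
    fixed-right fx fz = cancelˡ x (trans (cong (_· iterate g y k) (sym fx)) (trans (iterate-automorphism k x y) fz))

    fixed-left : iterate g y k ≡ y → iterate g (x · y) k ≡ x · y → iterate g x k ≡ x
    fixed-left fy fz = cancelʳ y (trans (cong (iterate g x k ·_) (sym fy)) (trans (iterate-automorphism k x y) fz))

  len-·-∣ : ∀ x y → len (x · y) ∣ lcm (len x) (len y)
  len-·-∣ x y = let k = lcm (len x) (len y) in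
    fixed⇒len∣ (fixed-· k (len∣⇒fixed {k = k} (m∣lcm[m,n] _ _)) (len∣⇒fixed {k = k} (n∣lcm[m,n] (len x) _)))

  len-right-∣ : ∀ x y → len y ∣ lcm (len x) (len (x · y))
  len-right-∣ x y = let k = lcm (len x) (len (x · y)) in
    fixed⇒len∣ (fixed-right k (len∣⇒fixed {k = k} (m∣lcm[m,n] _ _)) (len∣⇒fixed {k = k} (n∣lcm[m,n] (len x) _)))

  len-left-∣ : ∀ x y → len x ∣ lcm (len y) (len (x · y))
  len-left-∣ x y = let k = lcm (len y) (len (x · y)) in
    fixed⇒len∣ (fixed-left k (len∣⇒fixed {k = k} (m∣lcm[m,n] _ _)) (len∣⇒fixed {k = k} (n∣lcm[m,n] (len y) _)))

  -- Each of the three lengths divides the lcm of the other two, so replacing one member of a pair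
  -- by the third length does not change the lcm.
  lcm-left≡ : ∀ x y → lcm (len x) (len y) ≡ lcm (len x) (len (x · y))
  lcm-left≡ x y = ∣-antisym
    (lcm-least (m∣lcm[m,n] (len x) (len (x · y))) (len-right-∣ x y))
    (lcm-least (m∣lcm[m,n] (len x) (len y)) (len-·-∣ x y))

  lcm-right≡ : ∀ x y → lcm (len x) (len (x · y)) ≡ lcm (len y) (len (x · y))
  lcm-right≡ x y = ∣-antisym
    (lcm-least (len-left-∣ x y) (n∣lcm[m,n] (len y) (len (x · y))))
    (lcm-least (len-right-∣ x y) (n∣lcm[m,n] (len x) (len (x · y))))

  -- A triple is recorded by its first two coordinates, on which the paratopism acts as σ.
  Cell : Set
  Cell = Fin n × Fin n

  σ : Cell → Cell
  σ (x , y) = g (x · y) , x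

  σ² : ∀ x y → iterate σ (x , y) 2 ≡ (g y , g (x · y))
  σ² x y = cong (λ w → g w , g (x · y)) (rotate x y)

  σ³ : ∀ x y → iterate σ (x , y) 3 ≡ (g x , g y)
  σ³ x y = trans (cong σ (σ² x y)) (cong (λ w → g w , g y) (rotate² x y))

  -- The cube of `σ` applies `g` to both coordinates and is therefore injective.
  σ-injective : ∀ {c c′} → σ c ≡ σ c′ → c ≡ c′
  σ-injective {x , y} {x′ , y′} eq =
    cong₂ _,_ (g-injective (cong proj₁ eq³)) (g-injective (cong proj₂ eq³))
    where
    eq³ : (g x , g y) ≡ (g x′ , g y′)
    eq³ = trans (sym (σ³ x y)) (trans (cong (λ c → σ (σ c)) eq) (σ³ x′ y′))

  iterate-σ-*3 : ∀ k x y → iterate σ (x , y) (k * 3) ≡ (iterate g x k , iterate g y k)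
  iterate-σ-*3 zero    x y = refl
  iterate-σ-*3 (suc k) x y = trans (cong (λ c → iterate σ c (k * 3)) (σ³ x y)) (iterate-σ-*3 k (g x) (g y))

  -- Triples with all coordinates on d-cycles

  module _ (d : ℕ) (d>0 : 0 < d)
    (closedˡ : ∀ {x y} → len x ≡ d → len y ≢ d → len (x · y) ≡ d) where

    private
      D : List (Fin n)
      D = points d

      inD? : Decidable (λ x → len x ≡ d)
      inD? = len≟d d

      instance
        d≢0 : NonZero d
        d≢0 = >-nonZero d>0

    -- Row x holds the |D| symbols of D in |D| columns, listed by `hits`. By `closedˡ` all n - |D|
    -- columns outside D are among them, which leaves 2|D| - n columns inside D.
    length-row : ∀ {x} → len x ≡ d → length (filter (λ y → inD? (x · y)) D) + n ≡ length D + length D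
    length-row {x} x∈D = begin
      length (filter hit? D) + n                             ≡⟨ cong (length (filter hit? D) +_) n≡ ⟩
      length (filter hit? D) + (length D + length outside)   ≡⟨ rearrange (length (filter hit? D)) (length D) _ ⟩
      length (filter hit? D) + length outside + length D     ≡⟨ cong (_+ length D) (cong₂ _+_ inner outer) ⟩
      length (filter inD? hits) + length (filter (¬? ∘ inD?) hits) + length D
        ≡⟨ cong (_+ length D) (length-filter-split inD? hits) ⟩
      length hits + length D                                 ≡⟨ cong (_+ length D) hits≡ ⟩
      length D + length D                                    ∎
      where
      open ≡-Reasoning
      rearrange : ∀ a b c → a + (b + c) ≡ a + c + b
      rearrange = solve-∀
      hit? : Decidable (λ y → len (x · y) ≡ d)
      hit? y = inD? (x · y)
      hits outside : List (Fin n)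
      hits = filter hit? (allFin n)
      outside = filter (¬? ∘ inD?) (allFin n)
      hits! : Unique hits
      hits! = Unique.filter⁺ hit? (Unique.allFin⁺ n)
      n≡ : n ≡ length D + length outside
      n≡ = trans (sym (length-tabulate {n = n} (λ i → i))) (sym (length-filter-split inD? (allFin n)))
      inner : length (filter hit? D) ≡ length (filter inD? hits)
      inner = Unique-≋⇒length≡ (Unique.filter⁺ hit? (points-Unique d)) (Unique.filter⁺ inD? hits!)
        (λ y∈ → let y∈D , hit = ∈-filter⁻ hit? {xs = D} y∈ in
          ∈-filter⁺ inD? (∈-filter⁺ hit? (∈-allFin _) hit) (∈-points⁻ d y∈D))
        (λ y∈ → let y∈hits , y∈D = ∈-filter⁻ inD? {xs = hits} y∈ in
          ∈-filter⁺ hit? (∈-points⁺ d y∈D) (proj₂ (∈-filter⁻ hit? {xs = allFin n} y∈hits)))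
      outer : length outside ≡ length (filter (¬? ∘ inD?) hits)
      outer = Unique-≋⇒length≡ (Unique.filter⁺ (¬? ∘ inD?) (Unique.allFin⁺ n)) (Unique.filter⁺ (¬? ∘ inD?) hits!)
        (λ y∈ → let _ , y∉D = ∈-filter⁻ (¬? ∘ inD?) {xs = allFin n} y∈ in
          ∈-filter⁺ (¬? ∘ inD?) (∈-filter⁺ hit? (∈-allFin _) (closedˡ x∈D y∉D)) y∉D)
        (λ y∈ → let _ , y∉D = ∈-filter⁻ (¬? ∘ inD?) {xs = hits} y∈ in
          ∈-filter⁺ (¬? ∘ inD?) (∈-allFin _) y∉D)
      hits≡ : length hits ≡ length D
      hits≡ = trans (sym (length-map (x ·_) hits))
        (Unique-≋⇒length≡ (Unique.map⁺ (cancelˡ x) hits!) (points-Unique d) to from)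
        where
        to : map (x ·_) hits ⊆ D
        to z∈ with y , y∈ , refl ← ∈-map⁻ (x ·_) z∈ = ∈-points⁺ d (proj₂ (∈-filter⁻ hit? {xs = allFin n} y∈))
        from : D ⊆ map (x ·_) hits
        from {z} z∈ with y , refl , _ ← row x z = ∈-map⁺ (x ·_) (∈-filter⁺ hit? (∈-allFin y) (∈-points⁻ d z∈))

    subcell? : Decidable (λ (c : Cell) → len (proj₁ c · proj₂ c) ≡ d)
    subcell? (x , y) = inD? (x · y)

    T : List Cell
    T = filter subcell? (cartesianProduct D D)

    length-T : length T + length D * n ≡ length D * (length D + length D)
    length-T = length-filter-cartesianProduct subcell? D n (length D + length D) D (λ x∈ → length-row (∈-points⁻ d x∈))

    T-Unique : Unique T
    T-Unique = Unique.filter⁺ subcell? (Unique.cartesianProduct⁺ (points-Unique d) (points-Unique d))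

    ∈-T⁻ : ∀ {x y} → (x , y) ∈ T → len x ≡ d × len y ≡ d × len (x · y) ≡ d
    ∈-T⁻ c∈ with c∈D² , z∈D ← ∈-filter⁻ subcell? {xs = cartesianProduct D D} c∈
      with x∈D , y∈D ← ∈-cartesianProduct⁻ D D c∈D² = ∈-points⁻ d x∈D , ∈-points⁻ d y∈D , z∈D

    ∈-T⁺ : ∀ {x y} → len x ≡ d → len y ≡ d → len (x · y) ≡ d → (x , y) ∈ T
    ∈-T⁺ x∈D y∈D z∈D = ∈-filter⁺ subcell? (∈-cartesianProduct⁺ (∈-points⁺ d x∈D) (∈-points⁺ d y∈D)) z∈D

    σ-T : ∀ {c} → c ∈ T → σ c ∈ T
    σ-T {x , y} c∈ with x∈D , y∈D , z∈D ← ∈-T⁻ c∈ =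
      ∈-T⁺ (trans (len-g (x · y)) z∈D) x∈D (trans (cong len (rotate x y)) y∈D)

    -- Orbits of `σ` on the triples inside D³

    _≟ᶜ_ : DecidableEquality Cell
    _≟ᶜ_ = Product.≡-dec Fin._≟_ Fin._≟_

    fixed? : Decidable (λ c → iterate σ c d ≡ c)
    fixed? c = iterate σ c d ≟ᶜ c

    -- `F` consists of the orbits of length d and `G` of those of length 3d.
    F G : List Cell
    F = filter fixed? T
    G = filter (¬? ∘ fixed?) T

    -- If k steps of `σ` fix the cell, so do 3k steps, and these apply the k-th power of `g` to x,
    -- whose cycle has length d. Hence every period on `T` is a multiple of d.
    iterate-σ-fixed⇒∣ : ∀ {c k} → c ∈ T → iterate σ c k ≡ c → d ∣ k
    iterate-σ-fixed⇒∣ {x , y} {k} c∈ fix with x∈D , _ ← ∈-T⁻ c∈ = subst (_∣ k) x∈D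
      (fixed⇒len∣ (cong proj₁ (trans (sym (iterate-σ-*3 k x y)) (iterate-∣ σ (x , y) {k} fix (m∣m*n 3)))))

    iterate-σ-3d : ∀ {c} → c ∈ T → iterate σ c (3 * d) ≡ c
    iterate-σ-3d {x , y} c∈ with x∈D , y∈D , _ ← ∈-T⁻ c∈ = trans (cong (iterate σ (x , y)) (*-comm 3 d))
      (trans (iterate-σ-*3 d x y) (cong₂ _,_ (len∣⇒fixed (subst (_∣ d) (sym x∈D) ∣-refl)) (len∣⇒fixed (subst (_∣ d) (sym y∈D) ∣-refl))))

    d∣length-F : d ∣ length F
    d∣length-F = length-free-orbits _≟ᶜ_ σ d F (Unique.filter⁺ fixed? T-Unique) closed per
      where
      closed : ∀ {c} → c ∈ F → σ c ∈ F
      closed {c} c∈ with c∈T , fix ← ∈-filter⁻ fixed? {xs = T} c∈ =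
        ∈-filter⁺ fixed? (σ-T c∈T) (trans (iterate-suc σ c d) (cong σ fix))
      per : ∀ {c} → c ∈ F → IsPeriod σ c d
      per c∈ with c∈T , fix ← ∈-filter⁻ fixed? {xs = T} c∈ = record
        { positive = d>0 ; returns = fix
        ; minimal = λ 0<k k<d fixᵏ → >⇒∤ {{>-nonZero 0<k}} k<d (iterate-σ-fixed⇒∣ c∈T fixᵏ) }

    -- Return times are multiples of d, and 3d is one of them, so only d and 2d have to be excluded.
    3d∣length-G : 3 * d ∣ length G
    3d∣length-G = length-free-orbits _≟ᶜ_ σ (3 * d) G (Unique.filter⁺ (¬? ∘ fixed?) T-Unique) closed per
      where
      closed : ∀ {c} → c ∈ G → σ c ∈ G
      closed {c} c∈ with c∈T , ¬fix ← ∈-filter⁻ (¬? ∘ fixed?) {xs = T} c∈ =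
        ∈-filter⁺ (¬? ∘ fixed?) (σ-T c∈T) (λ fix → ¬fix (σ-injective (trans (sym (iterate-suc σ c d)) fix)))
      minimal : ∀ {c} → c ∈ T → iterate σ c d ≢ c → ∀ {k} → d ∣ k → 0 < k → k < 3 * d → iterate σ c k ≢ c
      minimal     c∈ ¬fix (divides 0 refl) 0<k k<3d fixᵏ = contradiction 0<k (<-irrefl refl)
      minimal {c} c∈ ¬fix (divides 1 refl) 0<k k<3d fixᵏ = ¬fix (trans (cong (iterate σ c) (sym (+-identityʳ d))) fixᵏ)
      -- If 2d steps fix c, then the 3d steps that also fix it amount to d steps, contradicting
      -- membership in `G`.
      minimal {c} c∈ ¬fix (divides 2 refl) 0<k k<3d fixᵏ = ¬fix (begin
        iterate σ c d                        ≡⟨ cong (λ c → iterate σ c d) fixᵏ ⟨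
        iterate σ (iterate σ c (2 * d)) d    ≡⟨ iterate-+ σ c (2 * d) d ⟨
        iterate σ c (2 * d + d)              ≡⟨ cong (iterate σ c) (+-comm (2 * d) d) ⟩
        iterate σ c (3 * d)                  ≡⟨ iterate-σ-3d c∈ ⟩
        c                                    ∎)
        where open ≡-Reasoning
      minimal     c∈ ¬fix (divides (suc (suc (suc q))) refl) 0<k k<3d fixᵏ =
        contradiction k<3d (≤⇒≯ (*-monoˡ-≤ d (s≤s (s≤s (s≤s (z≤n {q}))))))
      per : ∀ {c} → c ∈ G → IsPeriod σ c (3 * d)
      per c∈ with c∈T , ¬fix ← ∈-filter⁻ (¬? ∘ fixed?) {xs = T} c∈ = record
        { positive = ≤-trans d>0 (m≤m+n d (2 * d)) ; returns = iterate-σ-3d c∈T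
        ; minimal = λ 0<k k<3d fixᵏ → minimal c∈T ¬fix (iterate-σ-fixed⇒∣ c∈T fixᵏ) 0<k k<3d fixᵏ }

    -- For d = 3k, d steps of `σ` act as the k-th power of `g` on each coordinate. A fixed cell
    -- would make the cycle length 3k of x divide k, with k positive.
    3∣d⇒F-empty : 3 ∣ d → ∀ {c} → ¬ (c ∈ F)
    3∣d⇒F-empty (divides zero refl) c∈ = contradiction d>0 (<-irrefl refl)
    3∣d⇒F-empty (divides k@(suc _) refl) {x , y} c∈ with c∈T , fix ← ∈-filter⁻ fixed? {xs = T} c∈
      with x∈D , _ ← ∈-T⁻ c∈T =
      >⇒∤ (m<m*n k 3 (s≤s (s≤s z≤n)))
        (subst (_∣ k) x∈D (fixed⇒len∣ (cong proj₁ (trans (sym (iterate-σ-*3 k x y)) fix))))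

    3∣d⇒length-F≡0 : 3 ∣ d → length F ≡ 0
    3∣d⇒length-F≡0 3∣d = n≤0⇒n≡0 (Unique-⊆⇒length≤ {ys = []} (Unique.filter⁺ fixed? T-Unique) (⊥-elim ∘ 3∣d⇒F-empty 3∣d))

    -- The first 3k of the d steps act coordinatewise by the k-th power of `g`, leaving e explicit
    -- steps of `σ` that reveal how x and y are related.
    iterate-σ-fixed : ∀ {x y} k e → d ≡ e + k * 3 → (x , y) ∈ F → iterate σ (iterate g x k , iterate g y k) e ≡ (x , y)
    iterate-σ-fixed {x} {y} k e d≡ c∈ = begin
      iterate σ (iterate g x k , iterate g y k) e   ≡⟨ cong (λ c → iterate σ c e) (iterate-σ-*3 k x y) ⟨
      iterate σ (iterate σ (x , y) (k * 3)) e       ≡⟨ iterate-+ σ (x , y) (k * 3) e ⟨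
      iterate σ (x , y) (k * 3 + e)                 ≡⟨ cong (iterate σ (x , y)) (trans (+-comm (k * 3) e) (sym d≡)) ⟩
      iterate σ (x , y) d                           ≡⟨ proj₂ (∈-filter⁻ fixed? {xs = T} c∈) ⟩
      (x , y)                                       ∎
      where open ≡-Reasoning

    -- A cell fixed by σᵈ is determined by one of its coordinates: if d = 3k + 1 then
    -- y = xγᵏ, and if d = 3k + 2 then x = yγᵏ⁺¹.
    length-F≤-residue : ∀ k e → e < 3 → d ≡ e + k * 3 → length F ≤ length D
    length-F≤-residue k 0 _ d≡ = subst (_≤ length D) (sym (3∣d⇒length-F≡0 (divides k d≡))) z≤n
    length-F≤-residue k 1 _ d≡ =
      subst (length F ≤_) (length-map pair D) (Unique-⊆⇒length≤ (Unique.filter⁺ fixed? T-Unique) graph)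
      where
      pair : Fin n → Cell
      pair x = x , iterate g x k
      graph : F ⊆ map pair D
      graph {x , y} c∈ with x∈D , _ ← ∈-T⁻ (proj₁ (∈-filter⁻ fixed? {xs = T} c∈)) =
        subst (_∈ map pair D) (cong (x ,_) (cong proj₂ (iterate-σ-fixed k 1 d≡ c∈)))
          (∈-map⁺ pair (∈-points⁺ d x∈D))
    length-F≤-residue k 2 _ d≡ =
      subst (length F ≤_) (length-map pair D) (Unique-⊆⇒length≤ (Unique.filter⁺ fixed? T-Unique) graph)
      where
      pair : Fin n → Cell
      pair y = g (iterate g y k) , y
      graph : F ⊆ map pair D
      graph {x , y} c∈ with _ , y∈D , _ ← ∈-T⁻ (proj₁ (∈-filter⁻ fixed? {xs = T} c∈)) =
        subst (_∈ map pair D)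
          (cong (_, y) (cong proj₁ (trans (sym (σ² (iterate g x k) (iterate g y k))) (iterate-σ-fixed k 2 d≡ c∈))))
          (∈-map⁺ pair (∈-points⁺ d y∈D))
    length-F≤-residue k (suc (suc (suc _))) (s≤s (s≤s (s≤s ()))) _

    length-F≤ : length F ≤ length D
    length-F≤ = length-F≤-residue (d / 3) (d % 3) (m%n<n d 3) (m≡m%n+[m/n]*n d 3)

    -- Here q = |F| / d and s = |G| / 3d: the row count of |T| is set equal to |F| + |G| and divided
    -- by d.
    orbit-equation : let r = numCycles γ d in
      ∃[ q ] ∃[ s ] (q ≤ r × (3 ∣ d → q ≡ 0) × q + 3 * s + r * n ≡ r * (r * d + r * d))
    orbit-equation = divide-by-d d n (numCycles γ d) d∣length-F 3d∣length-G (length-points d)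
      length-F≤ 3∣d⇒length-F≡0 (trans (cong (_+ length D * n) (length-filter-split fixed? T)) length-T)

theorem5p1 : (n : ℕ) (γ : Permutation′ n) (d : ℕ) → 0 < d →
    let σ = paratopism (id ∷ id ∷ γ ∷ []) c123
        r = numCycles γ d
    in
    ¬ (∃[ d′ ] ∃[ d″ ] (d′ ∈ cycleLengths γ × d″ ∈ cycleLengths γ
        × d ≢ d′ × d ≢ d″
        × lcm d d′ ≡ lcm d d″ × lcm d d″ ≡ lcm d′ d″)) →
    (r ≡ 1 × (n + d) % 3 ≡ 1) ⊎ (3 ∣ d × 3 ∤ n * r) →
    σ ∉ Par n
theorem5p1 n γ d d>0 noLengths hyp (L , L^σ⊆L , _) =
  let q , s , q≤r , q≡0 , eq = orbit-equation d d>0 closedˡ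
  in no-solution n d (numCycles γ d) q s q≤r q≡0 eq hyp
  where
  open LatinSquare L renaming (entry to _·_)
  open Cycles γ
  rotate : ∀ x y → g (x · y) · x ≡ y
  -- The triple (x, y, x · y) of `L` is sent to (g (x · y), x, y), and membership of this image in
  -- `O L` is the equation sought.
  rotate x y = L^σ⊆L (x ∷ y ∷ (x · y) ∷ [] , refl , refl)
  open Cells γ L rotate
  closedˡ : ∀ {x y} → len x ≡ d → len y ≢ d → len (x · y) ≡ d
  -- Were x · y outside D as well, the lengths of y and x · y would serve as the excluded d′ and d″.
  closedˡ {x} {y} refl y∉D = decidable-stable (len (x · y) ≟ d) (λ z∉D → noLengths
    (len y , len (x · y) , len-∈ y , len-∈ (x · y) , y∉D ∘ sym , z∉D ∘ sym , lcm-left≡ x y , lcm-right≡ x y))
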